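{- Let $\rho=12\cdots(k-1)k^a$ for some $a\ge1$, $k\ge1$ (a strictly increasing run $1,\dots,k$ followed by $a-1$ further copies of $k$). If patterns $\sigma$ and $\tau$ are strongly partition equivalent, then $p_n(\rho,\sigma)=p_n(\rho,\tau)$ for all $n\ge0$.
   Context: Set partitions are written in canonical sequential form (restricted growth words; $\pi_j$ is the index of the block containing $j$, blocks ordered by their minima, so the $i$-th block is the set of positions carrying letter $i$). Pattern containment means having a subsequence order-isomorphic to the pattern. $p_n(T)$ is the number of partitions of $[n]$ avoiding all patterns in $T$. Patterns $\sigma,\tau$ are strongly partition equivalent if there is a bijection $f$ from $\sigma$-avoiding partitions to $\tau$-avoiding partitions such that for every $\sigma$-avoiding partition $\pi$, $f(\pi)$ has the same number of blocks as $\pi$ and for each $i$ the $i$-th block of $f(\pi)$ has the same size as the $i$-th block of $\pi$. -}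

module Defs where

open import Data.Empty using (⊥)
open import Data.Fin.Base using (cast)
open import Data.Fin.Properties using (all?)
open import Data.List.Base
  using (List; []; _∷_; _++_; length; lookup; map; concat; filter; deduplicate; applyUpTo; replicate)
import Data.List.Properties as List
open import Data.List.Membership.Propositional using (_∈_)
open import Data.List.Membership.Propositional.Properties
  using (∈-map⁺; ∈-map⁻; ∈-concat⁺′; ∈-concat⁻′; ∈-applyUpTo⁺; ∈-applyUpTo⁻)
import Data.List.Relation.Unary.All as All
import Data.List.Relation.Unary.All.Properties as All
open import Data.List.Relation.Unary.Any using (here)
import Data.List.Relation.Unary.AllPairs as AllPairs
import Data.List.Relation.Unary.AllPairs.Properties as AllPairs
open import Data.List.Relation.Unary.Unique.Propositional using (Unique)
import Data.List.Relation.Unary.Unique.Propositional.Properties as Unique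
open import Data.List.Relation.Binary.Sublist.Propositional using (_⊆_; []; _∷_; _∷ʳ_)
open import Data.Nat.Base using (ℕ; zero; suc; _∸_; _⊔_; _≤_; _<_; z≤n; s≤s)
open import Data.Nat.Properties using (_≟_; _<?_; <-irrefl)
open import Data.Product.Base using (Σ-syntax; ∃-syntax; _×_; _,_; proj₁)
open import Data.Refinement using (Refinement-syntax; value)
open import Data.Sum.Base using (inj₁; inj₂; [_,_])
open import Function.Base using (_∘_)
open import Function.Bundles using (_⇔_; mk⇔; Equivalence; _⤖_; Bijection)
open import Relation.Binary.PropositionalEquality using (_≡_; refl)
open import Relation.Nullary using (Dec; yes; no; ¬_; ¬?)
open import Relation.Nullary.Decidable using (map′; _×-dec_; _→-dec_; _⊎-dec_)
open import Relation.Unary using (Decidable)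

infix 4 _Contains_ _Avoids_ _avoids?_

-- A pattern is just a word: every set partition, in canonical form, is one.
Word : Set
Word = List ℕ

------------------------------------------------------------------------
-- Set partitions in canonical sequential form

-- RestrictedGrowth m w: w may follow a canonical word whose largest
-- letter is m (m = 0 for the empty word).
data RestrictedGrowth : ℕ → Word → Set where
  []  : ∀ {m} → RestrictedGrowth m []
  _∷_ : ∀ {m x w} → 1 ≤ x × x ≤ suc m → RestrictedGrowth (m ⊔ x) w →
        RestrictedGrowth m (x ∷ w)

-- The canonical words of length n are the partitions of [n]: the letter
-- in position j is the index, counted from 1, of the block containing j.
Canonical : Word → Set
Canonical = RestrictedGrowth 0

numBlocks : Word → ℕ
numBlocks w = length (deduplicate _≟_ w)

-- The i-th block is the set of positions carrying the letter i, so this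
-- is 0 if there is no i-th block.
blockSize : Word → ℕ → ℕ
blockSize w i = length (filter (i ≟_) w)

------------------------------------------------------------------------
-- Pattern containment

OrderIsomorphic : Word → Word → Set
OrderIsomorphic u v = Σ[ eq ∈ length u ≡ length v ] (∀ i j →
  lookup u i < lookup u j ⇔ lookup v (cast eq i) < lookup v (cast eq j))

_Contains_ : Word → Word → Set
w Contains τ = ∃[ u ] (u ⊆ w × OrderIsomorphic u τ)

_Avoids_ : Word → Word → Set
w Avoids τ = ¬ (w Contains τ)

orderIsomorphic? : ∀ u v → Dec (OrderIsomorphic u v)
orderIsomorphic? u v with length u ≟ length v
... | no  ne = no (ne ∘ proj₁)
... | yes eq = map′ (eq ,_) (λ (_ , h) → h)
  (all? λ i → all? λ j →
    (lookup u i <? lookup u j) ⇔? (lookup v (cast eq i) <? lookup v (cast eq j)))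
  where
  _⇔?_ : ∀ {A B : Set} → Dec A → Dec B → Dec (A ⇔ B)
  a? ⇔? b? = map′ (λ (f , g) → mk⇔ f g) (λ e → Equivalence.to e , Equivalence.from e)
                  ((a? →-dec b?) ×-dec (b? →-dec a?))

anySublist? : ∀ {P : Word → Set} → Decidable P → ∀ w → Dec (∃[ u ] (u ⊆ w × P u))
anySublist? P? [] = map′ (λ p → [] , [] , p) (λ { (_ , [] , p) → p }) (P? [])
anySublist? P? (x ∷ w) = map′
  [ (λ (u , s , p) → u , x ∷ʳ s , p) , (λ (u , s , p) → x ∷ u , refl ∷ s , p) ]
  (λ { (u , .x ∷ʳ s , p)          → inj₁ (u , s , p)
     ; (.x ∷ u , refl ∷ s , p)    → inj₂ (u , s , p) })
  (anySublist? P? w ⊎-dec anySublist? (P? ∘ (x ∷_)) w)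

_avoids?_ : ∀ w τ → Dec (w Avoids τ)
w avoids? τ = ¬? (anySublist? (λ u → orderIsomorphic? u τ) w)

------------------------------------------------------------------------
-- Counting

-- growths m n: the words of length n that may follow a canonical word
-- with largest letter m; growthsFrom m n y: those of length suc n whose
-- first letter is suc y.
growths     : ℕ → ℕ → List Word
growthsFrom : ℕ → ℕ → ℕ → List Word

growths m zero    = [] ∷ []
growths m (suc n) = concat (applyUpTo (growthsFrom m n) (suc m))

growthsFrom m n y = map (suc y ∷_) (growths (m ⊔ suc y) n)

partitions : ℕ → List Word
partitions = growths 0

growths-complete : ∀ {m w} → RestrictedGrowth m w → w ∈ growths m (length w)
growths-complete [] = here refl
growths-complete {m} (_∷_ {x = suc y} {w} (_ , y<1+m) g) =
  ∈-concat⁺′ (∈-map⁺ (suc y ∷_) (growths-complete g)) (∈-applyUpTo⁺ (growthsFrom m (length w)) y<1+m)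

growths-sound : ∀ m n {w} → w ∈ growths m n → RestrictedGrowth m w × length w ≡ n
growths-sound m zero (here refl) = [] , refl
growths-sound m (suc n) w∈
  with ∈-concat⁻′ (applyUpTo (growthsFrom m n) (suc m)) w∈
... | _ , w∈ws , ws∈
  with ∈-applyUpTo⁻ (growthsFrom m n) ws∈
... | y , y<1+m , refl
  with ∈-map⁻ (suc y ∷_) w∈ws
... | v , v∈ , refl
  with growths-sound (m ⊔ suc y) n v∈
... | g , refl = (s≤s z≤n , y<1+m) ∷ g , refl

growths-unique : ∀ m n → Unique (growths m n)
growths-unique m zero    = All.[] AllPairs.∷ AllPairs.[]
growths-unique m (suc n) = Unique.concat⁺
  (All.applyUpTo⁺₂ (growthsFrom m n) (suc m)
    (λ y → Unique.map⁺ List.∷-injectiveʳ (growths-unique (m ⊔ suc y) n)))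
  (AllPairs.applyUpTo⁺₁ (growthsFrom m n) (suc m)
    (λ i<j _ (v∈i , v∈j) → disjoint i<j v∈i v∈j))
  where
  disjoint : ∀ {i j v} → i < j → v ∈ growthsFrom m n i → v ∈ growthsFrom m n j → ⊥
  disjoint {i} {j} i<j v∈i v∈j with ∈-map⁻ (suc i ∷_) v∈i | ∈-map⁻ (suc j ∷_) v∈j
  ... | _ , _ , refl | _ , _ , refl = <-irrefl refl i<j

∈-partitions : ∀ n {w} → w ∈ partitions n ⇔ (Canonical w × length w ≡ n)
∈-partitions n = mk⇔ (growths-sound 0 n) (λ { (g , refl) → growths-complete g })

partitions-unique : ∀ n → Unique (partitions n)
partitions-unique = growths-unique 0

p : ℕ → List Word → ℕ
p n T = length (filter (λ w → All.all? (w avoids?_) T) (partitions n))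

------------------------------------------------------------------------
-- Strong partition equivalence

Avoider : Word → Set
Avoider τ = [ w ∈ Word ∣ Canonical w × w Avoids τ ]

StronglyEquivalent : Word → Word → Set
StronglyEquivalent σ τ = Σ[ f ∈ Avoider σ ⤖ Avoider τ ] (∀ (π : Avoider σ) →
  let w  = value π
      w′ = value (Bijection.to f π)
  in numBlocks w′ ≡ numBlocks w × (∀ i → blockSize w′ i ≡ blockSize w i))

-- 12⋯(k-1)kᵃ
ρ : ℕ → ℕ → Word
ρ k a = applyUpTo suc (k ∸ 1) ++ replicate a k

{-# OPTIONS --safe #-}
module Submission where

-- A canonical word contains 12⋯(k-1)kᵃ exactly when some block with index
-- i ≥ k has at least a elements: the first occurrences of 1, …, k-1 all come
-- before the letters i, and conversely the repeated letter of a copy of the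
-- pattern exceeds k-1 distinct positive letters. So avoiding ρ depends only on
-- the block sizes, which also determine the length, and the bijection between
-- the avoiders of σ and those of τ restricts to the partitions of [n] avoiding ρ.

open import Defs
open import Data.Fin.Base using (zero; suc; cast)
open import Data.Irrelevant using ([_])
open import Data.List.Base
  using (List; []; _∷_; _++_; length; lookup; map; filter; applyUpTo; replicate)
open import Data.List.Properties
  using (≡-dec; length-map; length-applyUpTo; length-replicate;
         filter-accept; filter-reject)
open import Data.List.Membership.Propositional using (_∈_)
open import Data.List.Membership.Propositional.Properties
  using (∈-map⁺; ∈-map⁻; ∈-filter⁺; ∈-filter⁻; ∈-∃++; ∈-lookup)
open import Data.List.Membership.Propositional.Properties.WithK using (unique∧set⇒bag)
open import Data.List.Relation.Binary.BagAndSetEquality using (∼bag⇒↭)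
open import Data.List.Relation.Binary.Permutation.Propositional using (_↭_)
open import Data.List.Relation.Binary.Permutation.Propositional.Properties
  using (↭-length; filter-↭; shift)
open import Data.List.Relation.Binary.Pointwise as Pointwise using (Pointwise; Pointwise-length)
open import Data.List.Relation.Binary.Sublist.Propositional using (_⊆_; _∷_; _∷ʳ_; ⊆-trans; ⊆-refl; minimum)
open import Data.List.Relation.Binary.Sublist.Propositional.Properties using (All-resp-⊆)
open import Data.List.Relation.Unary.All as All using (All; []; _∷_)
import Data.List.Relation.Unary.All.Properties as All
open import Data.List.Relation.Unary.AllPairs using (AllPairs; []; _∷_)
import Data.List.Relation.Unary.AllPairs.Properties as AllPairs
open import Data.List.Relation.Unary.Any as Any using (here; there)
open import Data.List.Relation.Unary.Any.Properties using (lookup-index)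
open import Data.List.Relation.Unary.Unique.Propositional using (Unique)
import Data.List.Relation.Unary.Unique.Propositional.Properties as Unique
open import Data.Nat.Base using (ℕ; zero; suc; _+_; _≤_; _<_; z≤n; s≤s; s≤s⁻¹; s<s)
open import Data.Nat.Properties
open import Data.List.Membership.DecPropositional (≡-dec _≟_) using (_∈?_)
open import Data.Product.Base using (∃-syntax; _×_; _,_; proj₁; proj₂)
open import Data.Refinement using (Refinement; _,_; value; value-injective)
open import Data.Sum.Base using (_⊎_; inj₁; inj₂)
open import Function.Base using (_∘_)
open import Function.Bundles using (_⇔_; mk⇔; Equivalence; _⤖_; Bijection)
open import Relation.Binary.PropositionalEquality
  using (_≡_; _≢_; refl; sym; trans; cong; subst; module ≡-Reasoning)
open import Relation.Nullary using (Dec; yes; no; contradiction)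
open import Relation.Nullary.Decidable using (map′; recompute)

open Equivalence using (to; from)

-- Counting through a bijection of refinement types

refine-all : ∀ {A : Set} {P : A → Set} {xs} → All P xs → ∃[ rs ] map (value {P = P}) rs ≡ xs
refine-all []         = [] , refl
refine-all (px ∷ pxs) with refine-all pxs
... | rs , refl = (_ , [ px ]) ∷ rs , refl

-- Since `f` acts on refinements, both lists are first lifted to them. The image of one lift and the
-- other lift are then duplicate-free with the same members, hence permutations of each other.
length-⤖ : ∀ {A B : Set} {P : A → Set} {Q : B → Set}
           (f : Refinement A P ⤖ Refinement B Q) {xs ys} →
           Unique xs → Unique ys → All P xs → All Q ys →
           (∀ r → value r ∈ xs ⇔ value (Bijection.to f r) ∈ ys) →
           length xs ≡ length ys
length-⤖ f xs! ys! pxs qys xs⇔ys with refine-all pxs | refine-all qys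
... | rs , refl | ss , refl = begin
  length (map value rs)            ≡⟨ length-map value rs ⟩
  length rs                        ≡⟨ length-map (Bijection.to f) rs ⟨
  length (map (Bijection.to f) rs) ≡⟨ ↭-length (∼bag⇒↭ (unique∧set⇒bag frs! ss! (mk⇔ fwd bwd))) ⟩
  length ss                        ≡⟨ length-map value ss ⟨
  length (map value ss)            ∎
  where
  open ≡-Reasoning
  frs! = Unique.map⁺ (Bijection.injective f) (Unique.map⁻ xs!)
  ss!  = Unique.map⁻ ys!

  -- The proof component is irrelevant, so refinements with equal values are equal.
  value∈⁻ : ∀ {C : Set} {R : C → Set} {r : Refinement C R} {rs} → value r ∈ map value rs → r ∈ rs
  value∈⁻ v∈ with ∈-map⁻ value v∈
  ... | _ , r∈ , eq = subst (_∈ _) (sym (value-injective eq)) r∈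

  fwd : ∀ {s} → s ∈ map (Bijection.to f) rs → s ∈ ss
  fwd s∈ with ∈-map⁻ (Bijection.to f) s∈
  ... | r , r∈ , refl = value∈⁻ (to (xs⇔ys r) (∈-map⁺ value r∈))

  bwd : ∀ {s} → s ∈ ss → s ∈ map (Bijection.to f) rs
  bwd {s} s∈ with Bijection.strictlySurjective f s
  ... | r , refl = ∈-map⁺ (Bijection.to f) (value∈⁻ (from (xs⇔ys r) (∈-map⁺ value s∈)))

-- An `Avoider` holds its proofs irrelevantly; deciding canonicity, here by search in a finite list,
-- allows it to be recomputed.
restrictedGrowth? : ∀ m w → Dec (RestrictedGrowth m w)
restrictedGrowth? m w =
  map′ (proj₁ ∘ growths-sound m (length w)) growths-complete (w ∈? growths m (length w))

-- Block sizes

blockSize-∷ : ∀ i w → blockSize (i ∷ w) i ≡ suc (blockSize w i)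
blockSize-∷ i w = cong length (filter-accept (i ≟_) refl)

blockSize-∷-≢ : ∀ {i x} w → i ≢ x → blockSize (x ∷ w) i ≡ blockSize w i
blockSize-∷-≢ {i} w i≢x = cong length (filter-reject (i ≟_) i≢x)

blockSize-↭ : ∀ {v w} → v ↭ w → ∀ i → blockSize v i ≡ blockSize w i
blockSize-↭ v↭w i = ↭-length (filter-↭ (i ≟_) v↭w)

blockSize-cancel : ∀ x v w i → blockSize (x ∷ v) i ≡ blockSize (x ∷ w) i → blockSize v i ≡ blockSize w i
blockSize-cancel x v w i eq with i ≟ x
... | yes refl = suc-injective (trans (sym (blockSize-∷ i v)) (trans eq (blockSize-∷ i w)))
... | no  i≢x  = trans (sym (blockSize-∷-≢ v i≢x)) (trans eq (blockSize-∷-≢ w i≢x))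

0<blockSize⇒∈ : ∀ {i} w → 0 < blockSize w i → i ∈ w
0<blockSize⇒∈ {i} (x ∷ w) 0< with i ≟ x
... | yes i≡x = here i≡x
... | no  i≢x = there (0<blockSize⇒∈ w (subst (0 <_) (blockSize-∷-≢ w i≢x) 0<))

-- Induction on `v`: its first letter has positive block size, so it occurs in `w` as well. Deleting
-- one occurrence from each word keeps all block sizes in agreement.
blockSize⇒length : ∀ v w → (∀ i → blockSize v i ≡ blockSize w i) → length v ≡ length w
blockSize⇒length []      []      eq = refl
blockSize⇒length []      (x ∷ w) eq = contradiction (trans (eq x) (blockSize-∷ x w)) λ ()
blockSize⇒length (x ∷ v) w       eq
  with ∈-∃++ (0<blockSize⇒∈ w (subst (0 <_) (trans (sym (blockSize-∷ x v)) (eq x)) 0<1+n))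
... | ys , zs , refl = trans
  (cong suc (blockSize⇒length v (ys ++ zs) λ i → blockSize-cancel x v (ys ++ zs) i
    (trans (eq i) (blockSize-↭ (shift x ys zs) i))))
  (sym (↭-length (shift x ys zs)))

replicate-⊆⇒≤blockSize : ∀ a {i w} → replicate a i ⊆ w → a ≤ blockSize w i
replicate-⊆⇒≤blockSize zero _ = z≤n
replicate-⊆⇒≤blockSize (suc a) {i} {x ∷ w} (.x ∷ʳ s) with i ≟ x
... | yes refl = subst (suc a ≤_) (sym (blockSize-∷ i w)) (m≤n⇒m≤1+n (replicate-⊆⇒≤blockSize (suc a) s))
... | no  i≢x  = subst (suc a ≤_) (sym (blockSize-∷-≢ w i≢x)) (replicate-⊆⇒≤blockSize (suc a) s)
replicate-⊆⇒≤blockSize (suc a) {i} {_ ∷ w} (refl ∷ s) =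
  subst (suc a ≤_) (sym (blockSize-∷ i w)) (s≤s (replicate-⊆⇒≤blockSize a s))

≤blockSize⇒replicate-⊆ : ∀ {a i} w → a ≤ blockSize w i → replicate a i ⊆ w
≤blockSize⇒replicate-⊆ {zero}      w       _ = minimum w
≤blockSize⇒replicate-⊆ {suc a} {i} (x ∷ w) a≤ with i ≟ x
... | yes refl = refl ∷ ≤blockSize⇒replicate-⊆ w (s≤s⁻¹ (subst (suc a ≤_) (blockSize-∷ i w) a≤))
... | no  i≢x  = x ∷ʳ ≤blockSize⇒replicate-⊆ w (subst (suc a ≤_) (blockSize-∷-≢ w i≢x) a≤)

-- Copies of an increasing run followed by a repeated letter

orderIsomorphic-tail : ∀ {x y u v} → OrderIsomorphic (x ∷ u) (y ∷ v) → OrderIsomorphic u v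
orderIsomorphic-tail (eq , h) = suc-injective eq , λ i j → h (suc i) (suc j)

-- Both directions of comparison are recorded because an order isomorphism sees equality of letters
-- only as neither being less.
orderIsomorphic-head : ∀ {x y u v} → OrderIsomorphic (x ∷ u) (y ∷ v) →
  ∀ {z} → z ∈ u → ∃[ z′ ] z′ ∈ v × (x < z ⇔ y < z′) × (z < x ⇔ z′ < y)
orderIsomorphic-head {x} {y} {u} {v} (eq , h) {z} z∈ =
  lookup v i′ , ∈-lookup i′ ,
  subst (λ z → x < z ⇔ y < lookup v i′) (sym (lookup-index z∈)) (h zero (suc i)) ,
  subst (λ z → z < x ⇔ lookup v i′ < y) (sym (lookup-index z∈)) (h (suc i) zero)
  where
  i  = Any.index z∈
  i′ = cast (suc-injective eq) i

-- This moves the check from pairs of positions to pairs of related letters.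
orderIsomorphic-pointwise : ∀ {R : ℕ → ℕ → Set} →
  (∀ {x y x′ y′} → R x y → R x′ y′ → x < x′ ⇔ y < y′) →
  ∀ {u v} → Pointwise R u v → OrderIsomorphic u v
orderIsomorphic-pointwise mono rs =
  Pointwise-length rs , λ i j → mono (Pointwise.lookup⁺ rs i) (Pointwise.lookup⁺ rs j)

all-≡⇒replicate : ∀ {x : ℕ} {w} → All (x ≡_) w → w ≡ replicate (length w) x
all-≡⇒replicate []           = refl
all-≡⇒replicate (refl ∷ eqs) = cong (_ ∷_) (all-≡⇒replicate eqs)

-- Equal letters of the pattern are incomparable under `<`, so the letters matched with them are
-- too, and these are equal by totality. The positive exponent guarantees a first letter to serve as
-- `i`.
orderIsomorphic-replicate : ∀ a {c u} → OrderIsomorphic u (replicate (suc a) c) →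
                            ∃[ i ] u ≡ replicate (suc a) i
orderIsomorphic-replicate a {c} {x ∷ u} iso = x , cong (x ∷_)
  (trans (all-≡⇒replicate (All.tabulate x≡))
         (cong (λ n → replicate n x) (trans (proj₁ (orderIsomorphic-tail iso)) (length-replicate a))))
  where
  x≡ : ∀ {z} → z ∈ u → x ≡ z
  x≡ z∈ with orderIsomorphic-head iso z∈
  ... | z′ , z′∈ , x<z⇔ , z<x⇔ with All.lookup (All.replicate⁺ {P = c ≡_} a refl) z′∈
  ... | refl = ≤-antisym (≮⇒≥ (<-irrefl refl ∘ to z<x⇔)) (≮⇒≥ (<-irrefl refl ∘ to x<z⇔))

-- The strict lower bound `m` is replaced by each letter of the run in turn and so rises by at least
-- one per step; the repeated letter lies above the last bound.
orderIsomorphic-ascending : ∀ {m a c u} v → AllPairs _<_ v → All (_< c) v → All (m <_) u →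
  OrderIsomorphic u (v ++ replicate (suc a) c) →
  ∃[ i ] m + length v < i × replicate (suc a) i ⊆ u
orderIsomorphic-ascending {m} {a} {c} {u} [] [] [] m<u iso with orderIsomorphic-replicate a {c} {u} iso
... | i , refl = i , subst (_< i) (sym (+-identityʳ m)) (All.head m<u) , ⊆-refl
orderIsomorphic-ascending {m} {a} {c} {x ∷ u} (y ∷ v) (y<v ∷ v↗) (y<c ∷ v<c) (m<x ∷ _) iso
  with orderIsomorphic-ascending v v↗ v<c (All.tabulate x<) (orderIsomorphic-tail iso)
  where
  x< : ∀ {z} → z ∈ u → x < z
  x< z∈ with orderIsomorphic-head iso z∈
  ... | z′ , z′∈ , x<z⇔ , _ = from x<z⇔ (All.lookup (All.++⁺ y<v (All.replicate⁺ (suc a) y<c)) z′∈)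
... | i , x+v<i , s = i , ≤-<-trans m+1+v≤x+v x+v<i , x ∷ʳ s
  where
  m+1+v≤x+v : m + suc (length v) ≤ x + length v
  m+1+v≤x+v = subst (_≤ x + length v) (sym (+-suc m (length v))) (+-monoˡ-≤ (length v) m<x)

-- The new maxima of a word following a canonical word with largest letter m
-- are m + 1, m + 2, … in this order, each before any larger letter.
ascent-⊆ : ∀ {m d i a w} f → (∀ j → f j ≡ suc (m + j)) →
  RestrictedGrowth m w → m + d < i → suc a ≤ blockSize w i →
  applyUpTo f d ++ replicate (suc a) i ⊆ w
ascent-⊆ {d = zero} {w = w} f f≡ g m+d<i a≤ = ≤blockSize⇒replicate-⊆ w a≤
ascent-⊆ {m} {suc d} {i} {w = x ∷ w} f f≡ ((_ , x≤1+m) ∷ g) m+d<i a≤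
  -- The first letter is at most `m + 1`, hence below `i`, so passing it loses no copy of `i`.
  with i≢x ← >⇒≢ (≤-<-trans x≤1+m (≤-<-trans (m<m+n m 0<1+n) m+d<i))
  with a≤′ ← subst (_ ≤_) (blockSize-∷-≢ w i≢x) a≤
  with x ≤? m
... | yes x≤m =
  x ∷ʳ ascent-⊆ f f≡ (subst (λ m → RestrictedGrowth m _) (m≥n⇒m⊔n≡m x≤m) g) m+d<i a≤′
... | no  x≰m with ≤-antisym x≤1+m (≰⇒> x≰m)
...   | refl = trans (f≡ 0) (cong suc (+-identityʳ m)) ∷
  -- The tail of `applyUpTo` runs over `f ∘ suc`, which fits the new maximum `m + 1`; this is why
  -- `f` is kept general.
  ascent-⊆ (f ∘ suc) (λ j → trans (f≡ (suc j)) (cong suc (+-suc m j)))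
    (subst (λ m → RestrictedGrowth m _) (m≤n⇒m⊔n≡n (n≤1+n m)) g)
    (subst (_< i) (+-suc m d) m+d<i) a≤′

letters-positive : ∀ {m w} → RestrictedGrowth m w → All (0 <_) w
letters-positive []            = []
letters-positive ((0<x , _) ∷ g) = 0<x ∷ letters-positive g

-- Containment of `ρ` in terms of block sizes

contains-ρ : ∀ {k a w} → 1 ≤ k → 1 ≤ a → Canonical w →
             w Contains ρ k a ⇔ (∃[ i ] k ≤ i × a ≤ blockSize w i)
contains-ρ {suc d} {suc a} {w} _ _ g = mk⇔ fwd bwd
  where
  run<k : All (_< suc d) (applyUpTo suc d)
  run<k = All.applyUpTo⁺₁ suc d s<s

  fwd : w Contains ρ (suc d) (suc a) → ∃[ i ] suc d ≤ i × suc a ≤ blockSize w i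
  fwd (u , u⊆w , iso)
    -- Letters are positive, so the lower bound starts at `0`; as `k` is `suc d`, the resulting
    -- `d < i` is `k ≤ i`.
    with orderIsomorphic-ascending (applyUpTo suc d) (AllPairs.applyUpTo⁺₁ suc d λ i<j _ → s<s i<j)
           run<k (All-resp-⊆ u⊆w (letters-positive g)) iso
  ... | i , d<i , s = i , subst (_< i) (length-applyUpTo suc d) d<i ,
                      replicate-⊆⇒≤blockSize (suc a) (⊆-trans s u⊆w)

  bwd : ∃[ i ] suc d ≤ i × suc a ≤ blockSize w i → w Contains ρ (suc d) (suc a)
  bwd (i , k≤i , a≤) = _ , ascent-⊆ suc (λ _ → refl) g k≤i a≤ ,
    orderIsomorphic-pointwise mono
      (Pointwise.++⁺ (diagonal run<k) (Pointwise.replicate⁺ (inj₂ (refl , refl)) (suc a)))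
    where
    -- The copy found in `w` ends in letters `i` where the pattern has `k`; letters below `k`
    -- correspond to themselves. Order is preserved because `k ≤ i`.
    R : ℕ → ℕ → Set
    R x y = (x ≡ y × x < suc d) ⊎ (x ≡ i × y ≡ suc d)

    diagonal : ∀ {v} → All (_< suc d) v → Pointwise R v v
    diagonal []         = Pointwise.[]
    diagonal (x<k ∷ xs) = inj₁ (refl , x<k) Pointwise.∷ diagonal xs

    mono : ∀ {x y x′ y′} → R x y → R x′ y′ → x < x′ ⇔ y < y′
    mono (inj₁ (refl , _))   (inj₁ (refl , _))   = mk⇔ (λ lt → lt) (λ lt → lt)
    mono (inj₁ (refl , x<k)) (inj₂ (refl , refl)) = mk⇔ (λ _ → x<k) (λ _ → <-≤-trans x<k k≤i)
    mono (inj₂ (refl , refl)) (inj₁ (refl , x<k)) =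
      mk⇔ (λ i<x → contradiction (<-≤-trans x<k k≤i) (<-asym i<x))
          (λ k<x → contradiction x<k (<-asym k<x))
    mono (inj₂ (refl , refl)) (inj₂ (refl , refl)) =
      mk⇔ (λ lt → contradiction lt (<-irrefl refl)) (λ lt → contradiction lt (<-irrefl refl))

avoids-ρ-resp : ∀ {k a v w} → 1 ≤ k → 1 ≤ a → Canonical v → Canonical w →
  (∀ i → blockSize v i ≡ blockSize w i) → v Avoids ρ k a → w Avoids ρ k a
avoids-ρ-resp {a = a} 1≤k 1≤a gv gw eq av cw with to (contains-ρ 1≤k 1≤a gw) cw
... | i , k≤i , a≤ = av (from (contains-ρ 1≤k 1≤a gv) (i , k≤i , subst (a ≤_) (sym (eq i)) a≤))

-- Counting the avoiders of two patterns

-- `p n T` unfolds to the length of this list.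
avoiders : ℕ → List Word → List Word
avoiders n T = filter (λ w → All.all? (w avoids?_) T) (partitions n)

∈-avoiders : ∀ n T {w} → w ∈ avoiders n T ⇔ (Canonical w × length w ≡ n × All (w Avoids_) T)
∈-avoiders n T = mk⇔
  (λ w∈ → let w∈p , av = ∈-filter⁻ (λ w → All.all? (w avoids?_) T) w∈
              g , len = to (∈-partitions n) w∈p
          in g , len , av)
  (λ (g , len , av) → ∈-filter⁺ (λ w → All.all? (w avoids?_) T) (from (∈-partitions n) (g , len)) av)

avoiders-unique : ∀ n T → Unique (avoiders n T)
avoiders-unique n T = Unique.filter⁺ (λ w → All.all? (w avoids?_) T) (partitions-unique n)

avoider-canonical : ∀ σ (π : Avoider σ) → Canonical (value π)
avoider-canonical σ (w , [ pf ]) = recompute (restrictedGrowth? 0 w) (proj₁ pf)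

avoider-avoids : ∀ σ (π : Avoider σ) → value π Avoids σ
avoider-avoids σ (w , [ pf ]) = recompute (w avoids? σ) (proj₂ pf)

theorem4p5 : ∀ (k a : ℕ) → 1 ≤ k → 1 ≤ a →
    ∀ (σ τ : Word) → StronglyEquivalent σ τ →
    ∀ (n : ℕ) → p n (ρ k a ∷ σ ∷ []) ≡ p n (ρ k a ∷ τ ∷ [])
theorem4p5 k a 1≤k 1≤a σ τ (f , preserves) n =
  length-⤖ f (avoiders-unique n _) (avoiders-unique n _)
    (All.tabulate (avoider σ)) (All.tabulate (avoider τ))
    λ π → let sizes = proj₂ (preserves π) in
      mk⇔ (transfer τ σ (Bijection.to f π) π sizes)
          (transfer σ τ π (Bijection.to f π) (sym ∘ sizes))
  where
  avoider : ∀ σ {w} → w ∈ avoiders n (ρ k a ∷ σ ∷ []) → Canonical w × w Avoids σ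
  avoider σ w∈ with to (∈-avoiders n (ρ k a ∷ σ ∷ [])) w∈
  ... | g , _ , _ ∷ av ∷ [] = g , av

  -- Quantifying over both patterns lets one argument serve `f` and its reverse. Avoidance of the
  -- second pattern comes from the type of `π′`; length and avoidance of `ρ` come from the block
  -- sizes.
  transfer : ∀ τ σ (π′ : Avoider τ) (π : Avoider σ) →
    (∀ i → blockSize (value π′) i ≡ blockSize (value π) i) →
    value π ∈ avoiders n (ρ k a ∷ σ ∷ []) → value π′ ∈ avoiders n (ρ k a ∷ τ ∷ [])
  transfer τ σ π′ π sizes π∈ with to (∈-avoiders n (ρ k a ∷ σ ∷ [])) π∈
  ... | g , len , av ∷ _ ∷ [] = from (∈-avoiders n (ρ k a ∷ τ ∷ []))
    ( avoider-canonical τ π′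
    , trans (blockSize⇒length (value π′) (value π) sizes) len
    , avoids-ρ-resp 1≤k 1≤a g (avoider-canonical τ π′) (sym ∘ sizes) av ∷ avoider-avoids τ π′ ∷ [])
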